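{- Let $n$ be odd and $k\ge 4$ even with $2k\le n$ and $n\equiv \pm 2 \pmod{k-1}$, and put $s=\frac{(n-4)(k-2)}{2(k-1)}$. Then there is a map $\sigma:\mathbb{Z}_n\to\mathbb{Z}_n$ such that for every edge $x_ix_j$ of $\mathrm{Pb}(n,k)$, the circular distance between $\sigma(i)$ and $\sigma(j)$ in $\mathbb{Z}_n$ is at least $s$; i.e., $\sigma$ is a homomorphism $\mathrm{Pb}(n,k)\to K_{n/s}$.
   Context: $\mathrm{Pb}(n,k)$ is the graph with vertex set $\{x_0,\dots,x_{n-1}\}$ (indices in $\mathbb{Z}_n$) in which $x_i$ is adjacent to $x_{i\pm1}$ and to $x_{i\pm k}$ (it is obtained from the generalized Petersen graph $\mathrm{Pet}(n,k)$ by identifying $u_i$ with $v_i$ for each $i$). For a real $s$ with $0<s\le n/2$, $K_{n/s}$ denotes the graph on $\mathbb{Z}_n=\{0,\dots,n-1\}$ in which $i\sim j$ iff $s\le |i-j|\le n-s$ (equivalently, the circular distance $\min(|i-j|,n-|i-j|)$ is at least $s$). -}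

module Defs where

open import Data.Fin.Base using (Fin; toℕ)
open import Data.Integer.Base as ℤ using (ℤ; +_)
open import Data.Integer.Divisibility.Signed as ℤ using ()
open import Data.Nat.Base as ℕ using (ℕ; NonZero; ∣_-_∣; _∸_; _⊓_)
open import Data.Nat.Properties using (m<n⇒0<n∸m; m*n≢0; ≤-trans)
open import Data.Product.Base using (_×_)
open import Data.Rational.Base as ℚ using (ℚ)
open import Data.Sum.Base using (_⊎_)
open import Level using (0ℓ)
open import Relation.Binary.Core using (Rel)

infix 4 _≡_[mod_]

_≡_[mod_] : ℤ → ℤ → ℤ → Set
a ≡ b [mod m ] = m ℤ.∣ (a ℤ.- b)

toℤ : ∀ {n} → Fin n → ℤ
toℤ i = + toℕ i

fromℕ : ℕ → ℚ
fromℕ m = + m ℚ./ 1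

-- Z_n is represented by Fin n, i.e. by its residues 0, …, n-1; the vertex x_i
-- of Pb(n,k) is identified with its index i.

Pb : (n k : ℕ) → Rel (Fin n) 0ℓ
Pb n k i j = toℤ j ≡ toℤ i ℤ.+ + 1 [mod + n ]
           ⊎ toℤ j ≡ toℤ i ℤ.- + 1 [mod + n ]
           ⊎ toℤ j ≡ toℤ i ℤ.+ + k [mod + n ]
           ⊎ toℤ j ≡ toℤ i ℤ.- + k [mod + n ]

-- K n s is the adjacency relation of K_{n/s}. It is the intended graph for
-- 0 < s ≤ n/2.
K : (n : ℕ) (s : ℚ) → Rel (Fin n) 0ℓ
K n s i j = s ℚ.≤ fromℕ ∣ toℕ i - toℕ j ∣
          × fromℕ ∣ toℕ i - toℕ j ∣ ℚ.≤ fromℕ n ℚ.- s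

-- The truncated subtraction never truncates, as |i-j| < n.
circularDistance : ∀ {n} → Fin n → Fin n → ℕ
circularDistance {n} i j = ∣ toℕ i - toℕ j ∣ ⊓ (n ∸ ∣ toℕ i - toℕ j ∣)

2[k-1]≢0 : ∀ {k} → 4 ℕ.≤ k → NonZero (2 ℕ.* (k ∸ 1))
2[k-1]≢0 {k} 4≤k = m*n≢0 2 (k ∸ 1)
  where instance _ = ℕ.>-nonZero (m<n⇒0<n∸m (≤-trans (ℕ.s≤s (ℕ.s≤s ℕ.z≤n)) 4≤k))

-- (n-4)(k-2) / (2(k-1)); the bound on k only serves to make the denominator
-- nonzero.
bound : (n k : ℕ) → .(4 ℕ.≤ k) → ℚ
bound n k 4≤k =
  ℚ._/_ ((+ n ℤ.- + 4) ℤ.* (+ k ℤ.- + 2)) (2 ℕ.* (k ∸ 1)) {{2[k-1]≢0 4≤k}}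

{-# OPTIONS --safe #-}
-- Write n = t(k-1) + 2δ with δ = ±1 and multiply indices by m = (n-t)/2. An edge
-- x_i x_{i±1} goes to a pair differing by ±m, and since k is even, km = (k/2)(n-t)
-- is -kt/2 mod n, so an edge x_i x_{i±k} goes to a pair differing by ∓kt/2. Both m
-- and kt/2 are within (n + 4(k-2)) / (2(k-1)) = n/2 - s of n/2.
module Submission where

open import Defs
open import Data.Fin.Base using (Fin; toℕ)
open import Data.Fin.Properties using (toℕ<n; toℕ-fromℕ<)
open import Data.Integer.Base as ℤ using (+_; 1ℤ; -1ℤ)
import Data.Integer.Divisibility.Signed as ℤ
import Data.Integer.Properties as ℤ
import Data.Integer.Tactic.RingSolver as ℤSolver
open import Data.Nat.Base as ℕ using (ℕ; zero; suc; NonZero; _≤_; _<_; z≤n; s≤s; ∣_-_∣; _∸_; _⊓_)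
open import Data.Nat.Divisibility using (_∣_; divides)
open import Data.Nat.DivMod using (_mod_; _%_; _/_; m%n<n; m≡m%n+[m/n]*n)
import Data.Nat.Properties as ℕ
import Data.Nat.Tactic.RingSolver as ℕSolver
open import Data.Product.Base using (∃; _×_; _,_)
open import Data.Rational.Base as ℚ using ()
import Data.Rational.Properties as ℚ
open import Data.Rational.Unnormalised.Base as ℚᵘ using (mkℚᵘ; *≤*; *≡*)
import Data.Rational.Unnormalised.Properties as ℚᵘ
open import Data.Sum.Base as Sum using (_⊎_; inj₁; inj₂)
open import Relation.Binary.Morphism.Definitions using (Homomorphic₂)
open import Relation.Binary.PropositionalEquality
open import Relation.Nullary.Negation.Core using (¬_; contradiction)

-- Comparing rationals with natural numbers.

/≤fromℕ : ∀ i d .{{_ : NonZero d}} m → i ℤ.≤ + (m ℕ.* d) → i ℚ./ d ℚ.≤ fromℕ m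
-- `_/_` reduces to lowest terms, so the comparison moves to unnormalised fractions, where it is a
-- cross-multiplication.
/≤fromℕ i d@(suc d-1) m i≤md = ℚ.toℚᵘ-cancel-≤
  (ℚᵘ.≤-respˡ-≃ (ℚᵘ.≃-sym (ℚ.toℚᵘ-fromℚᵘ (mkℚᵘ i d-1)))
  (ℚᵘ.≤-respʳ-≃ (ℚᵘ.≃-sym (ℚ.toℚᵘ-fromℚᵘ (mkℚᵘ (+ m) 0)))
  (*≤* (subst₂ ℤ._≤_ (sym (ℤ.*-identityʳ i)) (ℤ.pos-* m d) i≤md))))

fromℕ-mono-≤ : ∀ {l m} → l ≤ m → fromℕ l ℚ.≤ fromℕ m
fromℕ-mono-≤ {l} {m} l≤m =
  /≤fromℕ (+ l) 1 m (ℤ.+≤+ (subst (l ≤_) (sym (ℕ.*-identityʳ m)) l≤m))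

fromℕ-homo-+ : ∀ l m → fromℕ (l ℕ.+ m) ≡ fromℕ l ℚ.+ fromℕ m
fromℕ-homo-+ l m = ℚ.toℚᵘ-injective (begin
  ℚ.toℚᵘ (fromℕ (l ℕ.+ m))                  ≈⟨ ℚ.toℚᵘ-fromℚᵘ (mkℚᵘ (+ (l ℕ.+ m)) 0) ⟩
  mkℚᵘ (+ (l ℕ.+ m)) 0                      ≈⟨ *≡* (cong (ℤ._* 1ℤ)
                                                 (sym (cong₂ ℤ._+_ (ℤ.*-identityʳ (+ l)) (ℤ.*-identityʳ (+ m))))) ⟩
  mkℚᵘ (+ l) 0 ℚᵘ.+ mkℚᵘ (+ m) 0            ≈⟨ ℚᵘ.+-cong (ℚ.toℚᵘ-fromℚᵘ (mkℚᵘ (+ l) 0)) (ℚ.toℚᵘ-fromℚᵘ (mkℚᵘ (+ m) 0)) ⟨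
  ℚ.toℚᵘ (fromℕ l) ℚᵘ.+ ℚ.toℚᵘ (fromℕ m)    ≈⟨ ℚ.toℚᵘ-homo-+ (fromℕ l) (fromℕ m) ⟨
  ℚ.toℚᵘ (fromℕ l ℚ.+ fromℕ m)              ∎)
  where open ℚᵘ.≃-Reasoning

-- With d = |i-j| ≤ n the difference n - d is exact, so s ≤ n - d turns into the upper bound d ≤ n -
-- s.
circularDistance⇒K : ∀ {n} s (i j : Fin n) → s ℚ.≤ fromℕ (circularDistance i j) → K n s i j
circularDistance⇒K {n} s i j s≤ =
  ℚ.≤-trans s≤ (fromℕ-mono-≤ (ℕ.m⊓n≤m d (n ∸ d))) , (begin
    fromℕ d                                          ≡⟨ lemma (fromℕ d) (fromℕ (n ∸ d)) ⟩
    (fromℕ d ℚ.+ fromℕ (n ∸ d)) ℚ.- fromℕ (n ∸ d)    ≡⟨ cong (ℚ._- fromℕ (n ∸ d)) (fromℕ-homo-+ d (n ∸ d)) ⟨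
    fromℕ (d ℕ.+ (n ∸ d)) ℚ.- fromℕ (n ∸ d)          ≡⟨ cong (λ m → fromℕ m ℚ.- fromℕ (n ∸ d)) (ℕ.m+[n∸m]≡n d≤n) ⟩
    fromℕ n ℚ.- fromℕ (n ∸ d)                        ≤⟨ ℚ.+-monoʳ-≤ (fromℕ n) (ℚ.neg-antimono-≤
                                                          (ℚ.≤-trans s≤ (fromℕ-mono-≤ (ℕ.m⊓n≤n d (n ∸ d))))) ⟩
    fromℕ n ℚ.- s                                    ∎)
  where
  open ℚ.≤-Reasoning
  d : ℕ
  d = ∣ toℕ i - toℕ j ∣
  d≤n : d ≤ n
  d≤n = ℕ.≤-trans (ℕ.∣m-n∣≤m⊔n (toℕ i) (toℕ j))
          (ℕ.⊔-lub (ℕ.<⇒≤ (toℕ<n i)) (ℕ.<⇒≤ (toℕ<n j)))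
  lemma : ∀ p q → p ≡ (p ℚ.+ q) ℚ.- q
  lemma p q = sym (trans (ℚ.+-assoc p q (ℚ.- q))
    (trans (cong (p ℚ.+_) (ℚ.+-inverseʳ q)) (ℚ.+-identityʳ p)))

-- Residues and circular distance.

-- m + d is a multiple of n below 2n, hence 0 or n: either m and d both vanish, or m is n - d.
≡-neg⇒complement : ∀ {n m d c} → m < n → d ℕ.+ c ≡ n → + n ℤ.∣ + m ℤ.+ + d → m ≡ d ⊎ m ≡ c
≡-neg⇒complement {n} {m} {d} {c} m<n d+c≡n n∣m+d with ℤ.∣⇒∣ᵤ n∣m+d
... | divides 0 m+d≡0 = inj₁ (trans (ℕ.m+n≡0⇒m≡0 m m+d≡0) (sym (ℕ.m+n≡0⇒n≡0 m m+d≡0)))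
... | divides 1 m+d≡n = inj₂ (ℕ.+-cancelʳ-≡ d m c
        (trans m+d≡n (trans (ℕ.*-identityˡ n) (trans (sym d+c≡n) (ℕ.+-comm d c)))))
... | divides (suc (suc q)) m+d≡ = contradiction
        (ℕ.<-≤-trans (ℕ.+-mono-<-≤ m<n d≤n) (ℕ.+-monoʳ-≤ n (ℕ.m≤m+n n (q ℕ.* n))))
        (ℕ.<-irrefl m+d≡)
  where
  d≤n : d ≤ n
  d≤n = subst (d ≤_) d+c≡n (ℕ.m≤m+n d c)

≡-±⇒complement : ∀ {n m d c} → m < n → d ℕ.+ c ≡ n →
  + m ≡ + d [mod + n ] ⊎ + m ≡ ℤ.- + d [mod + n ] → m ≡ d ⊎ m ≡ c
≡-±⇒complement {n} {m} {d} {c} m<n d+c≡n (inj₂ m≡-d) =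
  ≡-neg⇒complement m<n d+c≡n (subst (λ e → + n ℤ.∣ + m ℤ.+ e) (ℤ.neg-involutive (+ d)) m≡-d)
≡-±⇒complement {n} {m} {d} {c} m<n d+c≡n (inj₁ m≡d) =
  -- Modulo n, d is -c, so `≡-neg⇒complement` applies with d and c exchanged.
  Sum.swap (≡-neg⇒complement m<n (trans (ℕ.+-comm c d) d+c≡n)
    (subst (+ n ℤ.∣_) eq (ℤ.∣m∣n⇒∣m+n m≡d ℤ.∣-refl)))
  where
  lemma : ∀ m d c → (m ℤ.- d) ℤ.+ (d ℤ.+ c) ≡ m ℤ.+ c
  lemma = ℤSolver.solve-∀
  eq : (+ m ℤ.- + d) ℤ.+ + n ≡ + m ℤ.+ + c
  eq = trans (cong (λ e → (+ m ℤ.- + d) ℤ.+ + e) (sym d+c≡n)) (lemma (+ m) (+ d) (+ c))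

∣-∣-residue : ∀ {n d c x y} → x < n → y < n → d ℕ.+ c ≡ n →
  + y ≡ + x ℤ.+ + d [mod + n ] ⊎ + y ≡ + x ℤ.- + d [mod + n ] → ∣ x - y ∣ ≡ d ⊎ ∣ x - y ∣ ≡ c
∣-∣-residue {n} {d} {c} {x} {y} x<n y<n d+c≡n y≡x±d with ℕ.≤-total x y
... | inj₁ x≤y rewrite ℕ.m≤n⇒∣m-n∣≡n∸m x≤y =
  ≡-±⇒complement (ℕ.≤-<-trans (ℕ.m∸n≤m y x) y<n) d+c≡n
    (Sum.map (shift (+ d)) (shift (ℤ.- + d)) y≡x±d)
  where
  lemma : ∀ x y e → y ℤ.- (x ℤ.+ e) ≡ (y ℤ.- x) ℤ.- e
  lemma = ℤSolver.solve-∀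
  shift : ∀ e → + y ≡ + x ℤ.+ e [mod + n ] → + (y ∸ x) ≡ e [mod + n ]
  shift e = subst (+ n ℤ.∣_) (trans (lemma (+ x) (+ y) e)
    (cong (ℤ._- e) (trans (ℤ.m-n≡m⊖n y x) (ℤ.⊖-≥ x≤y))))
... | inj₂ y≤x rewrite ℕ.m≤n⇒∣n-m∣≡n∸m y≤x =
  ≡-±⇒complement (ℕ.≤-<-trans (ℕ.m∸n≤m x y) x<n) d+c≡n
    -- Here |x-y| is x - y, the negative of y - x, so the residues d and -d trade places.
    (Sum.swap (Sum.map (shift (+ d) (ℤ.- + d) refl) (shift (ℤ.- + d) (+ d) (sym (ℤ.neg-involutive (+ d)))) y≡x±d))
  where
  lemma : ∀ x y e → ℤ.- (y ℤ.- (x ℤ.+ e)) ≡ (x ℤ.- y) ℤ.- (ℤ.- e)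
  lemma = ℤSolver.solve-∀
  shift : ∀ e e′ → e′ ≡ ℤ.- e → + y ≡ + x ℤ.+ e [mod + n ] → + (x ∸ y) ≡ e′ [mod + n ]
  shift e _ refl h = subst (+ n ℤ.∣_) (trans (lemma (+ x) (+ y) e)
    (cong (ℤ._- (ℤ.- e)) (trans (ℤ.m-n≡m⊖n x y) (ℤ.⊖-≥ y≤x)))) (ℤ.∣m⇒∣-m h)

circularDistance-residue : ∀ {n d c} (x y : Fin n) → d ℕ.+ c ≡ n →
  toℤ y ≡ toℤ x ℤ.+ + d [mod + n ] ⊎ toℤ y ≡ toℤ x ℤ.- + d [mod + n ] →
  circularDistance x y ≡ d ⊓ c
circularDistance-residue {d = d} {c} x y refl y≡x±d
  with ∣-∣-residue (toℕ<n x) (toℕ<n y) refl y≡x±d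
... | inj₁ eq = cong₂ _⊓_ eq (trans (cong (d ℕ.+ c ∸_) eq) (ℕ.m+n∸m≡n d c))
... | inj₂ eq = trans (cong₂ _⊓_ eq (trans (cong (d ℕ.+ c ∸_) eq) (ℕ.m+n∸n≡m d c))) (ℕ.⊓-comm c d)

-- Multiplication of indices modulo n.

multiply : ∀ {n} .{{_ : NonZero n}} → ℕ → Fin n → Fin n
multiply {n} m i = (m ℕ.* toℕ i) mod n

multiply-≡ : ∀ {n} .{{_ : NonZero n}} m (i : Fin n) → toℤ (multiply m i) ≡ + m ℤ.* toℤ i [mod + n ]
multiply-≡ {n} m i = ℤ.divides (ℤ.- + (a / n)) (begin
  toℤ (a mod n) ℤ.- + m ℤ.* toℤ i           ≡⟨ cong₂ ℤ._-_ (cong +_ (toℕ-fromℕ< (m%n<n a n))) (sym (ℤ.pos-* m (toℕ i))) ⟩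
  + (a % n) ℤ.- + a                         ≡⟨ cong (λ b → + (a % n) ℤ.- + b) (m≡m%n+[m/n]*n a n) ⟩
  + (a % n) ℤ.- (+ (a % n) ℤ.+ + (a / n ℕ.* n)) ≡⟨ cong (λ b → + (a % n) ℤ.- (+ (a % n) ℤ.+ b)) (ℤ.pos-* (a / n) n) ⟩
  + (a % n) ℤ.- (+ (a % n) ℤ.+ + (a / n) ℤ.* + n) ≡⟨ lemma (+ (a % n)) (+ (a / n)) (+ n) ⟩
  ℤ.- + (a / n) ℤ.* + n                     ∎)
  where
  open ≡-Reasoning
  a : ℕ
  a = m ℕ.* toℕ i
  lemma : ∀ r q n → r ℤ.- (r ℤ.+ q ℤ.* n) ≡ ℤ.- q ℤ.* n
  lemma = ℤSolver.solve-∀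

multiply-shift : ∀ {n} .{{_ : NonZero n}} m (i j : Fin n) {c e} →
  + m ℤ.* c ≡ e [mod + n ] → toℤ j ≡ toℤ i ℤ.+ c [mod + n ] →
  toℤ (multiply m j) ≡ toℤ (multiply m i) ℤ.+ e [mod + n ]
multiply-shift {n} m i j {c} {e} mc≡e j≡i+c =
  -- The multiples of n combined here are the reduction errors of the two images, m times the
  -- congruence of the edge, and mc - e.
  subst (+ n ℤ.∣_) (lemma (toℤ (multiply m i)) (toℤ (multiply m j)) (+ m) (toℤ i) (toℤ j) c e)
    (ℤ.∣m∣n⇒∣m+n
      (ℤ.∣m∣n⇒∣m-n (multiply-≡ m j) (multiply-≡ m i))
      (ℤ.∣m∣n⇒∣m+n (ℤ.∣n⇒∣m*n (+ m) j≡i+c) mc≡e))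
  where
  lemma : ∀ x y m i j c e →
    ((y ℤ.- m ℤ.* j) ℤ.- (x ℤ.- m ℤ.* i)) ℤ.+ (m ℤ.* (j ℤ.- (i ℤ.+ c)) ℤ.+ (m ℤ.* c ℤ.- e))
    ≡ y ℤ.- (x ℤ.+ e)
  lemma = ℤSolver.solve-∀

circularDistance-multiply : ∀ {n} .{{_ : NonZero n}} {k m d} → + m ℤ.* + k ≡ ℤ.- + d [mod + n ] →
  ∀ {m′ d′} → m ℕ.+ m′ ≡ n → d ℕ.+ d′ ≡ n → (i j : Fin n) → Pb n k i j →
  circularDistance (multiply m i) (multiply m j) ≡ m ⊓ m′
  ⊎ circularDistance (multiply m i) (multiply m j) ≡ d ⊓ d′
circularDistance-multiply {n} {k} {m} {d} mk≡-d m+m′≡n d+d′≡n i j = distance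
  where
  ≡⇒≡mod : ∀ {a b} → a ≡ b → a ≡ b [mod + n ]
  ≡⇒≡mod {a} refl = ℤ.divides (+ 0) (ℤ.+-inverseʳ a)
  m*-1≡-m : ∀ m → m ℤ.* -1ℤ ≡ ℤ.- m
  m*-1≡-m = ℤSolver.solve-∀
  lemma : ∀ m k d → ℤ.- (m ℤ.* k ℤ.- (ℤ.- d)) ≡ m ℤ.* (ℤ.- k) ℤ.- d
  lemma = ℤSolver.solve-∀
  m*-k≡d : + m ℤ.* (ℤ.- + k) ≡ + d [mod + n ]
  m*-k≡d = subst (+ n ℤ.∣_) (lemma (+ m) (+ k) (+ d)) (ℤ.∣m⇒∣-m mk≡-d)
  distance : Pb n k i j → _ ⊎ _
  distance (inj₁ j≡i+1) = inj₁ (circularDistance-residue (multiply m i) (multiply m j) m+m′≡n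
    (inj₁ (multiply-shift m i j (≡⇒≡mod (ℤ.*-identityʳ (+ m))) j≡i+1)))
  distance (inj₂ (inj₁ j≡i-1)) = inj₁ (circularDistance-residue (multiply m i) (multiply m j) m+m′≡n
    (inj₂ (multiply-shift m i j (≡⇒≡mod (m*-1≡-m (+ m))) j≡i-1)))
  distance (inj₂ (inj₂ (inj₁ j≡i+k))) = inj₂ (circularDistance-residue (multiply m i) (multiply m j) d+d′≡n
    (inj₂ (multiply-shift m i j mk≡-d j≡i+k)))
  distance (inj₂ (inj₂ (inj₂ j≡i-k))) = inj₂ (circularDistance-residue (multiply m i) (multiply m j) d+d′≡n
    (inj₁ (multiply-shift m i j m*-k≡d j≡i-k)))

-- Distance estimates for the parametrised n and k.

-- g, u, a stand for (k-4)/2, t-2 and 1+δ: the case n = t(k-1) + 2 is a = 2, and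
-- n = t(k-1) - 2 is a = 0. A vertex at distance step, resp. turn, on one side is
-- at distance step′, resp. turn′, on the other.
module _ (g u a : ℕ) where

  -- These are n - 4, n, k, m = (n-t)/2 and kt/2, expanded in g, u, a so that no subtraction or
  -- halving remains.
  order-4 order jump step turn : ℕ
  order-4 = g ℕ.* 4 ℕ.+ u ℕ.* (3 ℕ.+ g ℕ.* 2) ℕ.+ a ℕ.* 2
  order   = 4 ℕ.+ order-4
  jump    = (2 ℕ.+ g) ℕ.* 2
  step    = 1 ℕ.+ g ℕ.* 2 ℕ.+ u ℕ.* (1 ℕ.+ g) ℕ.+ a
  turn    = (2 ℕ.+ g) ℕ.* (2 ℕ.+ u)

  step′ turn′ : ℕ
  step′ = step ℕ.+ (2 ℕ.+ u)
  turn′ = g ℕ.* 2 ℕ.+ u ℕ.* (1 ℕ.+ g) ℕ.+ a ℕ.* 2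

  step+step′≡order : step ℕ.+ step′ ≡ order
  step+step′≡order = lemma g u a
    where
    lemma : ∀ g u a → let m = 1 ℕ.+ g ℕ.* 2 ℕ.+ u ℕ.* (1 ℕ.+ g) ℕ.+ a in
      m ℕ.+ (m ℕ.+ (2 ℕ.+ u)) ≡ 4 ℕ.+ (g ℕ.* 4 ℕ.+ u ℕ.* (3 ℕ.+ g ℕ.* 2) ℕ.+ a ℕ.* 2)
    lemma = ℕSolver.solve-∀

  turn+turn′≡order : turn ℕ.+ turn′ ≡ order
  turn+turn′≡order = lemma g u a
    where
    lemma : ∀ g u a → (2 ℕ.+ g) ℕ.* (2 ℕ.+ u) ℕ.+ (g ℕ.* 2 ℕ.+ u ℕ.* (1 ℕ.+ g) ℕ.+ a ℕ.* 2)
      ≡ 4 ℕ.+ (g ℕ.* 4 ℕ.+ u ℕ.* (3 ℕ.+ g ℕ.* 2) ℕ.+ a ℕ.* 2)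
    lemma = ℕSolver.solve-∀

  -- Since 2m + t = n, the sum mk + kt/2 is (k/2)(2m + t) = (k/2)n; the quotient k/2 is 2 + g.
  step*jump≡-turn : + step ℤ.* + jump ≡ ℤ.- + turn [mod + order ]
  step*jump≡-turn = ℤ.divides (+ (2 ℕ.+ g)) (begin
    + step ℤ.* + jump ℤ.- (ℤ.- + turn)    ≡⟨ cong₂ ℤ._+_ (sym (ℤ.pos-* step jump)) (ℤ.neg-involutive (+ turn)) ⟩
    + (step ℕ.* jump ℕ.+ turn)            ≡⟨ cong +_ (lemma g u a) ⟩
    + ((2 ℕ.+ g) ℕ.* order)               ≡⟨ ℤ.pos-* (2 ℕ.+ g) order ⟩
    + (2 ℕ.+ g) ℤ.* + order               ∎)
    where
    open ≡-Reasoning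
    lemma : ∀ g u a →
      (1 ℕ.+ g ℕ.* 2 ℕ.+ u ℕ.* (1 ℕ.+ g) ℕ.+ a) ℕ.* ((2 ℕ.+ g) ℕ.* 2) ℕ.+ (2 ℕ.+ g) ℕ.* (2 ℕ.+ u)
      ≡ (2 ℕ.+ g) ℕ.* (4 ℕ.+ (g ℕ.* 4 ℕ.+ u ℕ.* (3 ℕ.+ g ℕ.* 2) ℕ.+ a ℕ.* 2))
    lemma = ℕSolver.solve-∀

  -- This is s ≤ d with the denominator 2(k-1) cleared, which keeps the estimates in ℕ.
  Far : ℕ → Set
  Far d = order-4 ℕ.* (2 ℕ.+ g ℕ.* 2) ≤ d ℕ.* (2 ℕ.* (3 ℕ.+ g ℕ.* 2))

  -- 2(k-1)m = (k-2)n + 2δ exceeds (k-2)(n-4) by 4(k-2) + 2δ, the slack added in `lemma`.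
  step-far : Far step
  step-far = ℕ.m+n≤o⇒m≤o _ (ℕ.≤-reflexive (lemma g u a))
    where
    lemma : ∀ g u a →
      (g ℕ.* 4 ℕ.+ u ℕ.* (3 ℕ.+ g ℕ.* 2) ℕ.+ a ℕ.* 2) ℕ.* (2 ℕ.+ g ℕ.* 2) ℕ.+ (a ℕ.* 2 ℕ.+ 6 ℕ.+ g ℕ.* 8)
      ≡ (1 ℕ.+ g ℕ.* 2 ℕ.+ u ℕ.* (1 ℕ.+ g) ℕ.+ a) ℕ.* (2 ℕ.* (3 ℕ.+ g ℕ.* 2))
    lemma = ℕSolver.solve-∀

  step′-far : Far step′
  step′-far = ℕ.≤-trans step-far (ℕ.*-monoˡ-≤ _ (ℕ.m≤m+n step (2 ℕ.+ u)))

  -- `turn` does not depend on a, while n grows with a; so it suffices to take a = 2, where the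
  -- slack is 2(k-1)t + 2(k-2).
  turn-far : a ≤ 2 → Far turn
  turn-far a≤2 = ℕ.≤-trans
    (ℕ.*-monoˡ-≤ (2 ℕ.+ g ℕ.* 2) (ℕ.+-monoʳ-≤ (g ℕ.* 4 ℕ.+ u ℕ.* (3 ℕ.+ g ℕ.* 2)) (ℕ.*-monoˡ-≤ 2 a≤2)))
    (ℕ.m+n≤o⇒m≤o _ (ℕ.≤-reflexive (lemma g u)))
    where
    lemma : ∀ g u →
      (g ℕ.* 4 ℕ.+ u ℕ.* (3 ℕ.+ g ℕ.* 2) ℕ.+ 4) ℕ.* (2 ℕ.+ g ℕ.* 2)
      ℕ.+ (2 ℕ.* (3 ℕ.+ g ℕ.* 2) ℕ.* (2 ℕ.+ u) ℕ.+ 4 ℕ.+ g ℕ.* 4)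
      ≡ (2 ℕ.+ g) ℕ.* (2 ℕ.+ u) ℕ.* (2 ℕ.* (3 ℕ.+ g ℕ.* 2))
    lemma = ℕSolver.solve-∀

  -- 2(k-1)(n - kt/2) = (k-2)n + 2δk, which leaves the slack 4(k-2) + 2δk. For δ = -1 this is
  -- 2(k-4), so k ≥ 4 is just enough and k = 4 gives equality.
  turn′-far : Far turn′
  turn′-far = ℕ.m+n≤o⇒m≤o _ (ℕ.≤-reflexive (lemma g u a))
    where
    lemma : ∀ g u a →
      (g ℕ.* 4 ℕ.+ u ℕ.* (3 ℕ.+ g ℕ.* 2) ℕ.+ a ℕ.* 2) ℕ.* (2 ℕ.+ g ℕ.* 2) ℕ.+ ((8 ℕ.+ g ℕ.* 4) ℕ.* a ℕ.+ g ℕ.* 4)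
      ≡ (g ℕ.* 2 ℕ.+ u ℕ.* (1 ℕ.+ g) ℕ.+ a ℕ.* 2) ℕ.* (2 ℕ.* (3 ℕ.+ g ℕ.* 2))
    lemma = ℕSolver.solve-∀

  far⇒bound : (4≤k : 4 ≤ jump) → ∀ d → Far d → bound order jump 4≤k ℚ.≤ fromℕ d
  far⇒bound 4≤k d far = /≤fromℕ _ _ d
    -- `order` and `jump` expose enough successors for the subtractions in `bound` to compute, so
    -- only the product in the numerator needs rewriting.
    (subst (ℤ._≤ + (d ℕ.* (2 ℕ.* (3 ℕ.+ g ℕ.* 2)))) (ℤ.pos-* order-4 (2 ℕ.+ g ℕ.* 2)) (ℤ.+≤+ far))

  far-⊓ : ∀ d d′ → Far d → Far d′ → Far (d ⊓ d′)
  far-⊓ d d′ far far′ with ℕ.⊓-sel d d′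
  ... | inj₁ eq = subst Far (sym eq) far
  ... | inj₂ eq = subst Far (sym eq) far′

  multiply-step-far : a ≤ 2 → ∀ i j → Pb order jump i j →
    Far (circularDistance (multiply step i) (multiply step j))
  multiply-step-far a≤2 i j i~j
    with circularDistance-multiply {k = jump} {step} {turn} step*jump≡-turn step+step′≡order turn+turn′≡order i j i~j
  ... | inj₁ eq = subst Far (sym eq) (far-⊓ step step′ step-far step′-far)
  ... | inj₂ eq = subst Far (sym eq) (far-⊓ turn turn′ (turn-far a≤2) turn′-far)

-- From the congruence to the parameters.

order-form : ∀ g t a n → 2 ℕ.* ((2 ℕ.+ g) ℕ.* 2) ≤ n → a ≤ 2 →
  n ℕ.+ 2 ≡ t ℕ.* (3 ℕ.+ g ℕ.* 2) ℕ.+ a ℕ.* 2 → ∃ λ u → n ≡ order g u a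
order-form g t a n 2k≤n a≤2 n+2≡ = t ∸ 2 , ℕ.+-cancelʳ-≡ 2 n (order g (t ∸ 2) a) (begin
  n ℕ.+ 2                                              ≡⟨ n+2≡ ⟩
  t ℕ.* (3 ℕ.+ g ℕ.* 2) ℕ.+ a ℕ.* 2                    ≡⟨ cong (λ t → t ℕ.* (3 ℕ.+ g ℕ.* 2) ℕ.+ a ℕ.* 2) (ℕ.m+[n∸m]≡n 2≤t) ⟨
  (2 ℕ.+ (t ∸ 2)) ℕ.* (3 ℕ.+ g ℕ.* 2) ℕ.+ a ℕ.* 2      ≡⟨ lemma g (t ∸ 2) a ⟩
  order g (t ∸ 2) a ℕ.+ 2                              ∎)
  where
  open ≡-Reasoning
  lemma : ∀ g u a → (2 ℕ.+ u) ℕ.* (3 ℕ.+ g ℕ.* 2) ℕ.+ a ℕ.* 2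
    ≡ 4 ℕ.+ (g ℕ.* 4 ℕ.+ u ℕ.* (3 ℕ.+ g ℕ.* 2) ℕ.+ a ℕ.* 2) ℕ.+ 2
  lemma = ℕSolver.solve-∀
  2k≡ : ∀ g → 2 ℕ.* ((2 ℕ.+ g) ℕ.* 2) ℕ.+ 2 ≡ 2 ℕ.* (3 ℕ.+ g ℕ.* 2) ℕ.+ 4
  2k≡ = ℕSolver.solve-∀
  2≤t : 2 ≤ t
  -- 2(k-1) + 4 = 2k + 2 ≤ n + 2 = t(k-1) + 2a ≤ t(k-1) + 4; cancel 4, then k - 1.
  2≤t = ℕ.*-cancelʳ-≤ 2 t (3 ℕ.+ g ℕ.* 2) (ℕ.+-cancelʳ-≤ 4 _ _
    (ℕ.≤-trans (subst₂ _≤_ (2k≡ g) n+2≡ (ℕ.+-monoˡ-≤ 2 2k≤n)) (ℕ.+-monoʳ-≤ _ (ℕ.*-monoˡ-≤ 2 a≤2))))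

-- The quotient t of n + 2 or n - 2 by k - 1 gives n + 2 = t(k-1) with a = 0, or n + 2 = t(k-1) + 4
-- with a = 2.
congruence⇒order : ∀ g n → 2 ℕ.* ((2 ℕ.+ g) ℕ.* 2) ≤ n →
  (+ n ≡ + 2 [mod + ((2 ℕ.+ g) ℕ.* 2) ℤ.- + 1 ]) ⊎ (+ n ≡ ℤ.- (+ 2) [mod + ((2 ℕ.+ g) ℕ.* 2) ℤ.- + 1 ]) →
  ∃ λ u → ∃ λ a → a ≤ 2 × n ≡ order g u a
congruence⇒order g n 2k≤n (inj₂ n≡-2) with ℤ.∣⇒∣ᵤ n≡-2
... | divides t n+2≡ =
  let u , n≡ = order-form g t 0 n 2k≤n z≤n (trans n+2≡ (sym (ℕ.+-identityʳ _))) in u , 0 , z≤n , n≡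
-- Splitting off two successors lets n - 2 compute to a natural number; smaller n contradict 2k ≤ n.
congruence⇒order g n@(suc (suc n-2)) 2k≤n (inj₁ n≡2) with ℤ.∣⇒∣ᵤ n≡2
... | divides t n-2≡ =
  let u , n≡ = order-form g t 2 n 2k≤n ℕ.≤-refl (trans (lemma n-2) (cong (ℕ._+ 4) n-2≡)) in u , 2 , ℕ.≤-refl , n≡
  where
  lemma : ∀ m → 2 ℕ.+ m ℕ.+ 2 ≡ m ℕ.+ 4
  lemma = ℕSolver.solve-∀
congruence⇒order g (suc zero) (s≤s ()) (inj₁ _)

theorem5 : (n k : ℕ) → ¬ (2 ∣ n) → (4≤k : 4 ℕ.≤ k) → 2 ∣ k → 2 ℕ.* k ℕ.≤ n →
    (+ n ≡ + 2 [mod + k ℤ.- + 1 ]) ⊎ (+ n ≡ ℤ.- (+ 2) [mod + k ℤ.- + 1 ]) →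
    ∃ λ (σ : Fin n → Fin n) →
    (∀ i j → Pb n k i j → bound n k 4≤k ℚ.≤ fromℕ (circularDistance (σ i) (σ j)))
    × Homomorphic₂ (Fin n) (Fin n) (Pb n k) (K n (bound n k 4≤k)) σ
theorem5 n k _ (s≤s (s≤s ())) (divides 1 refl) _ _
-- As k ≥ 4, the half k/2 is at least 2 and can be written 2 + g.
theorem5 n k _ 4≤k (divides (suc (suc g)) refl) 2k≤n n≡±2
  with congruence⇒order g n 2k≤n n≡±2
... | u , a , a≤2 , refl = σ , far , λ {i} {j} i~j → circularDistance⇒K _ (σ i) (σ j) (far i j i~j)
  where
  σ : Fin n → Fin n
  σ = multiply (step g u a)
  far : ∀ i j → Pb n k i j → bound n k 4≤k ℚ.≤ fromℕ (circularDistance (σ i) (σ j))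
  far i j i~j = far⇒bound g u a 4≤k (circularDistance (σ i) (σ j)) (multiply-step-far g u a a≤2 i j i~j)
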